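{- Let $n,r,k$ be integers with $n\ge r\ge 1$. If $0<k\le\frac{1}{3}r!$, then $f(n,r,k)=r$.
   Context: An $r$-digraph $G$ consists of a finite vertex set $V(G)$ and an edge set $E(G)$ whose elements are ordered lists of $r$ distinct vertices. An $(r,k)$-tournament is an $r$-digraph $G$ such that for every $r$-element set $S\subseteq V(G)$, exactly $k$ of the $r!$ orderings of $S$ are edges of $G$. The tight path $P^{(r)}_s$ is the $r$-digraph with $s$ distinct vertices $v_1,\ldots,v_s$ whose edges are exactly the lists of $r$ consecutive vertices $(v_i,v_{i+1},\ldots,v_{i+r-1})$, $1\le i\le s-r+1$ (so it has no edges if $s<r$). An $r$-digraph $G$ contains $P^{(r)}_s$ if there is an injection of its vertices into $V(G)$ mapping edges to edges (not necessarily induced). $f(n,r,k)$ is the maximum integer $s$ such that every $n$-vertex $(r,k)$-tournament contains a copy of $P^{(r)}_s$. -}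

module Defs where

open import Data.Fin.Base using (Fin; toℕ)
open import Data.Fin.Properties using (toℕ-injective)
open import Data.Fin.Subset using (Subset; ∣_∣) renaming (_∈_ to _∈ₛ_)
open import Data.List.Base using (List; length)
import Data.List.Membership.Propositional as List
import Data.List.Relation.Unary.Unique.Propositional as List
open import Data.Nat.Base using (ℕ; _+_; _≤_)
open import Data.Nat.Properties using (+-cancelˡ-≡)
open import Data.Product.Base using (Σ-syntax; ∃-syntax; _×_; _,_)
open import Data.Vec.Base using (Vec; map; tabulate; lookup)
import Data.Vec.Membership.Propositional as Vec
open import Data.Vec.Properties
  using (lookup-map; lookup∘tabulate; tabulate∘lookup)
import Data.Vec.Relation.Unary.Unique.Propositional as Vec
open import Data.Vec.Relation.Unary.Unique.Propositional.Properties
  using (tabulate⁺)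
open import Function.Bundles using (_⇔_)
open import Function.Definitions using (Injective)
open import Relation.Binary.PropositionalEquality
  using (_≡_; sym; trans; cong; subst)

-- Edges are not assumed decidable: for the tournaments below, decidability
-- follows from the exact edge counts.
record Digraph (r n : ℕ) : Set₁ where
  field
    Edge     : Vec (Fin n) r → Set
    distinct : ∀ {e} → Edge e → Vec.Unique e

open Digraph public

-- Exactly k elements satisfy P; only the truth of P x matters, not the
-- number of its proofs.
HasCardinality : {A : Set} → (A → Set) → ℕ → Set
HasCardinality {A} P k =
  Σ[ xs ∈ List A ]
    List.Unique xs × length xs ≡ k × (∀ x → (x List.∈ xs) ⇔ P x)

IsOrderingOf : ∀ {n r} → Subset n → Vec (Fin n) r → Set
IsOrderingOf S e = Vec.Unique e × (∀ v → (v Vec.∈ e) ⇔ (v ∈ₛ S))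

IsTournament : ∀ {r n} → ℕ → Digraph r n → Set
IsTournament {r} {n} k G =
  (S : Subset n) → ∣ S ∣ ≡ r →
  HasCardinality (λ e → IsOrderingOf S e × Edge G e) k

IsConsecutive : ∀ {r s} → Vec (Fin s) r → Set
IsConsecutive {r} {s} e =
  ∃[ i ] i + r ≤ s × map toℕ e ≡ tabulate (λ j → i + toℕ j)

IsConsecutive⇒Unique : ∀ {r s} {e : Vec (Fin s) r} →
                       IsConsecutive e → Vec.Unique e
IsConsecutive⇒Unique {e = e} (i , _ , eq) =
  subst Vec.Unique (tabulate∘lookup e) (tabulate⁺ inj)
  where
  position : ∀ j → toℕ (lookup e j) ≡ i + toℕ j
  position j =
    trans (sym (lookup-map j toℕ e))
      (trans (cong (λ v → lookup v j) eq) (lookup∘tabulate _ j))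

  inj : ∀ {j j′} → lookup e j ≡ lookup e j′ → j ≡ j′
  inj {j} {j′} p = toℕ-injective (+-cancelˡ-≡ i _ _
    (trans (sym (position j)) (trans (cong toℕ p) (position j′))))

tightPath : ∀ r s → Digraph r s
tightPath r s = record
  { Edge     = IsConsecutive
  ; distinct = IsConsecutive⇒Unique
  }

Contains : ∀ {r n m} → Digraph r n → Digraph r m → Set
Contains {n = n} {m = m} G H =
  Σ[ φ ∈ (Fin m → Fin n) ]
    Injective _≡_ _≡_ φ × (∀ e → Edge H e → Edge G (map φ e))

Unavoidable : (n r k s : ℕ) → Set₁
Unavoidable n r k s =
  (G : Digraph r n) → IsTournament k G → Contains G (tightPath r s)

-- The function f is given by its graph: f⟨ n , r , k ⟩≡ s says that s is the
-- maximum of the set of unavoidable path lengths.  (This maximum need not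
-- exist: for n ≥ r and k > r ! there are no tournaments at all.)
f⟨_,_,_⟩≡_ : (n r k s : ℕ) → Set₁
f⟨ n , r , k ⟩≡ s =
  Unavoidable n r k s × (∀ t → Unavoidable n r k t → t ≤ s)

{-# OPTIONS --safe #-}
module Submission where

-- Call a list of r ≥ 3 vertices, taken from a linearly ordered vertex set,
-- peaked when its last-but-one entry exceeds both its neighbours.  In a list
-- of r + 1 vertices the windows (v₁,…,vᵣ) and (v₂,…,vᵣ₊₁) cannot both be
-- peaked, as this would require vᵣ₋₁ > vᵣ and vᵣ > vᵣ₋₁.  Exactly one third of
-- the orderings of an r-set are peaked, so choosing k of these for every r-set
-- gives a tournament without a tight path on r + 1 vertices.

open import Defs
open import Data.Bool.Base using (true; false)
open import Data.Empty using (⊥)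
open import Data.Fin.Base as Fin
  using (Fin; zero; suc; toℕ; inject₁; inject≤; punchIn; punchOut)
open import Data.Fin.Properties
  using (_≟_; all?; <-asym; <-cmp; toℕ-injective; toℕ-inject₁; toℕ-inject≤;
         punchIn-injective; punchInᵢ≢i; punchIn-cancel-≤; punchIn-punchOut)
open import Data.Fin.Subset using (Subset; ∣_∣; inside)
  renaming (_∈_ to _∈ₛ_; ⊥ to ∅)
open import Data.Fin.Subset.Properties using (⊆-antisym; ∣⊥∣≡0)
open import Data.List.Base as List
  using (List; []; _∷_; length; take; cartesianProductWith; allFin)
import Data.List.Membership.Propositional as List
import Data.List.Membership.Propositional.Properties as List
open import Data.List.Properties
  using (length-map; length-++; length-take; length-tabulate)
open import Data.List.Relation.Binary.Sublist.Propositional using (lookup)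
open import Data.List.Relation.Binary.Sublist.Propositional.Properties
  using (take-⊆)
open import Data.List.Relation.Unary.All using ([]; _∷_)
open import Data.List.Relation.Unary.AllPairs using ([]; _∷_)
open import Data.List.Relation.Unary.Any using (here; there)
import Data.List.Relation.Unary.Unique.Propositional as List
import Data.List.Relation.Unary.Unique.Propositional.Properties as Listᵁ
open import Data.Nat.Base as ℕ
  using (ℕ; zero; suc; _+_; _*_; _≤_; _<_; _!; z≤n; s≤s)
import Data.Nat.Properties as ℕ
open import Data.Nat.Tactic.RingSolver using (solve-∀)
open import Data.Product.Base using (∃-syntax; Σ-syntax; _×_; _,_; proj₁; proj₂)
open import Data.Vec.Base as Vec using (Vec; []; _∷_; map; tabulate)
import Data.Vec.Membership.DecPropositional as VecDec
import Data.Vec.Membership.Propositional as Vec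
open import Data.Vec.Membership.Propositional.Properties using (∈-map⁺)
open import Data.Vec.Properties
  using (tabulate-∘; tabulate-cong; map-lookup-allFin; ∷-injective)
open import Data.Vec.Relation.Unary.All using (universal)
import Data.Vec.Relation.Unary.All.Properties as Allᵛ
open import Data.Vec.Relation.Unary.AllPairs using (_∷_; allPairs?)
import Data.Vec.Relation.Unary.Any as Anyᵛ
import Data.Vec.Relation.Unary.Any.Properties as Anyᵛ
import Data.Vec.Relation.Unary.Unique.Propositional as Vec
import Data.Vec.Relation.Unary.Unique.Propositional.Properties as Vecᵁ
open import Function.Base using (_∘_; id)
open import Function.Bundles using (mk⇔; Equivalence)
open import Function.Definitions using (Injective)
open import Relation.Binary.Definitions using (tri<; tri≈; tri>)
open import Relation.Binary.PropositionalEquality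
  using (_≡_; refl; sym; trans; cong; cong₂; subst; module ≡-Reasoning)
open import Relation.Nullary using (yes; no; contradiction)
open import Relation.Nullary.Decidable using (¬?; _×-dec_; from-yes)
open import Relation.Unary using (Decidable)

private
  open module Membership {n} = VecDec (_≟_ {n}) using (_∈?_)

  variable
    m n r k : ℕ

-- Order-preserving maps and injectivity.

StrictlyMonotone : (Fin m → Fin n) → Set
StrictlyMonotone f = ∀ {i j} → i Fin.< j → f i Fin.< f j

strictlyMonotone⇒injective : {f : Fin m → Fin n} →
                             StrictlyMonotone f → Injective _≡_ _≡_ f
strictlyMonotone⇒injective mono {i} {j} fi≡fj with <-cmp i j
... | tri< i<j _ _ = contradiction (cong toℕ fi≡fj) (ℕ.<⇒≢ (mono i<j))
... | tri≈ _ i≡j _ = i≡j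
... | tri> _ _ j<i = contradiction (cong toℕ (sym fi≡fj)) (ℕ.<⇒≢ (mono j<i))

punchIn-strictlyMonotone : (i : Fin (suc n)) → StrictlyMonotone (punchIn i)
punchIn-strictlyMonotone i j<k =
  ℕ.≰⇒> (ℕ.<⇒≱ j<k ∘ punchIn-cancel-≤ i _ _)

map-injective : ∀ {A B : Set} {f : A → B} → Injective _≡_ _≡_ f →
                Injective _≡_ _≡_ (map {n = n} f)
map-injective inj {[]}    {[]}    _  = refl
map-injective inj {_ ∷ _} {_ ∷ _} eq =
  cong₂ _∷_ (inj (proj₁ (∷-injective eq)))
            (map-injective inj (proj₂ (∷-injective eq)))

length-cartesianProductWith : ∀ {A B C : Set} (f : A → B → C) xs ys →
  length (cartesianProductWith f xs ys) ≡ length xs * length ys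
length-cartesianProductWith f []       ys = refl
length-cartesianProductWith f (x ∷ xs) ys = trans
  (length-++ (List.map (f x) ys))
  (cong₂ _+_ (length-map (f x) ys) (length-cartesianProductWith f xs ys))

-- Peaked lists.

Peak : ∀ m → Vec (Fin n) (3 + m) → Set
Peak zero    (a ∷ b ∷ c ∷ []) = a Fin.< b × c Fin.< b
Peak (suc m) (_ ∷ e)          = Peak m e

map-peak : ∀ {p q} {f : Fin p → Fin q} → StrictlyMonotone f →
           ∀ m {e} → Peak m e → Peak m (map f e)
map-peak mono zero    {_ ∷ _ ∷ _ ∷ []} (a<b , c<b) = mono a<b , mono c<b
map-peak mono (suc m) {_ ∷ _}          peak        = map-peak mono m peak

-- Dropping the first of the `4 + m` vertices shortens both windows at the front and keeps their
-- last three entries, so everything reduces to four vertices, where the two peaks compare the same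
-- middle pair in opposite directions.
consecutive-peaks : ∀ m (g : Fin (4 + m) → Fin n) →
  Peak m (tabulate (g ∘ inject₁)) → Peak m (tabulate (g ∘ suc)) → ⊥
consecutive-peaks zero    g (_ , g₂<g₁) (g₁<g₂ , _) =
  <-asym {x = g (suc (suc zero))} g₂<g₁ g₁<g₂
consecutive-peaks (suc m) g p           q           =
  consecutive-peaks m (g ∘ suc) p q

-- Counting peaked permutations.

extend : Fin (suc n) → Vec (Fin n) n → Vec (Fin (suc n)) (suc n)
extend i e = i ∷ map (punchIn i) e

-- The base case has the two orders of three values with the largest in the middle. A longer
-- permutation is a free choice of first entry followed by a permutation of the other values,
-- relabelled by `punchIn`; the first entry does not affect the peak.
peakPermutations : ∀ m → List (Vec (Fin (3 + m)) (3 + m))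
peakPermutations zero    =
  (zero ∷ suc (suc zero) ∷ suc zero ∷ []) ∷
  (suc zero ∷ suc (suc zero) ∷ zero ∷ []) ∷ []
peakPermutations (suc m) =
  cartesianProductWith extend (allFin (4 + m)) (peakPermutations m)

-- Two of the six orders of three values are peaked, and each new first entry multiplies both sides
-- by `4 + m`, so the ratio one third persists.
length-peakPermutations : ∀ m → 3 * length (peakPermutations m) ≡ (3 + m) !
length-peakPermutations zero    = refl
length-peakPermutations (suc m) = begin
  3 * length (peakPermutations (suc m))
    ≡⟨ cong (3 *_) (length-cartesianProductWith extend (allFin (4 + m))
                      (peakPermutations m)) ⟩
  3 * (length (allFin (4 + m)) * l)
    ≡⟨ cong (λ x → 3 * (x * l)) (length-tabulate {n = 4 + m} id) ⟩
  3 * ((4 + m) * l)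
    ≡⟨ swap (4 + m) l ⟩
  (4 + m) * (3 * l)
    ≡⟨ cong ((4 + m) *_) (length-peakPermutations m) ⟩
  (4 + m) ! ∎
  where
  open ≡-Reasoning
  l = length (peakPermutations m)

  swap : ∀ x y → 3 * (x * y) ≡ x * (3 * y)
  swap = solve-∀

peakPermutations-unique : ∀ m → List.Unique (peakPermutations m)
peakPermutations-unique zero    = ((λ ()) ∷ []) ∷ [] ∷ []
peakPermutations-unique (suc m) =
  Listᵁ.cartesianProductWith⁺ extend extend-injective
    (Listᵁ.allFin⁺ (4 + m)) (peakPermutations-unique m)
  where
  extend-injective : ∀ {i j e e′} → extend {n = 3 + m} i e ≡ extend j e′ →
                     i ≡ j × e ≡ e′
  extend-injective {i} eq with refl , eq′ ← ∷-injective eq =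
    refl , map-injective (punchIn-injective i _ _) eq′

IsPermutation : Vec (Fin n) n → Set
IsPermutation e = Vec.Unique e × (∀ i → i Vec.∈ e)

extend-isPermutation : ∀ i {e : Vec (Fin n) n} →
                       IsPermutation e → IsPermutation (extend i e)
extend-isPermutation i {e} (unique , complete) =
  (Allᵛ.map⁺ (universal (λ j → punchInᵢ≢i i j ∘ sym) e)
    ∷ Vecᵁ.map⁺ (punchIn-injective i _ _) unique) ,
  complete′
  where
  complete′ : ∀ j → j Vec.∈ extend i e
  complete′ j with i ≟ j
  ... | yes refl = Anyᵛ.here refl
  ... | no  i≢j  = Anyᵛ.there (subst (Vec._∈ map (punchIn i) e)
                     (punchIn-punchOut i≢j)
                     (∈-map⁺ (punchIn i) (complete (punchOut i≢j))))

isPermutation? : Decidable (IsPermutation {n})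
isPermutation? e = allPairs? (λ i j → ¬? (i ≟ j)) e ×-dec all? (_∈? e)

peakPermutations-sound : ∀ m {e} → e List.∈ peakPermutations m →
                         IsPermutation e × Peak m e
peakPermutations-sound zero {e} (here refl) =
  -- The decision procedure evaluates on this concrete list; the two inequalities are `0 < 2` and
  -- `1 < 2`.
  from-yes (isPermutation? e) , s≤s z≤n , s≤s (s≤s z≤n)
peakPermutations-sound zero {e} (there (here refl)) =
  from-yes (isPermutation? e) , s≤s (s≤s z≤n) , s≤s z≤n
peakPermutations-sound (suc m) e∈
  with i , e , _ , e∈ , refl ←
         List.∈-cartesianProductWith⁻ extend (allFin (4 + m))
           (peakPermutations m) e∈
  with perm , peak ← peakPermutations-sound m e∈ =
  extend-isPermutation i perm , map-peak (punchIn-strictlyMonotone i) m peak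

-- Subsets and their orderings.

enum : (S : Subset n) → Fin ∣ S ∣ → Fin n
enum (true  ∷ S) zero    = zero
enum (true  ∷ S) (suc i) = suc (enum S i)
enum (false ∷ S) i       = suc (enum S i)

enum-strictlyMonotone : (S : Subset n) → StrictlyMonotone (enum S)
enum-strictlyMonotone (true  ∷ S) {zero}  {suc j} _         = s≤s z≤n
enum-strictlyMonotone (true  ∷ S) {suc i} {suc j} (s≤s i<j) =
  s≤s (enum-strictlyMonotone S i<j)
enum-strictlyMonotone (false ∷ S) i<j = s≤s (enum-strictlyMonotone S i<j)

enum-∈ : (S : Subset n) → ∀ i → enum S i ∈ₛ S
enum-∈ (true  ∷ S) zero    = Vec.here
enum-∈ (true  ∷ S) (suc i) = Vec.there (enum-∈ S i)
enum-∈ (false ∷ S) i       = Vec.there (enum-∈ S i)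

enum-surjective : (S : Subset n) → ∀ {v} → v ∈ₛ S → ∃[ i ] enum S i ≡ v
enum-surjective (true  ∷ S) Vec.here = zero , refl
enum-surjective (true  ∷ S) (Vec.there v∈S) with i , refl ← enum-surjective S v∈S =
  suc i , refl
enum-surjective (false ∷ S) (Vec.there v∈S) with i , refl ← enum-surjective S v∈S =
  i , refl

-- Monotonicity is what carries peaks from permutations of `Fin r` to orderings of `S`. Keeping `r`
-- apart from `∣ S ∣` confines the transport along the size equation to `enumerate`.
record Enumeration (S : Subset n) (r : ℕ) : Set where
  field
    element    : Fin r → Fin n
    monotone   : StrictlyMonotone element
    ∈-set      : ∀ i → element i ∈ₛ S
    surjective : ∀ {v} → v ∈ₛ S → ∃[ i ] element i ≡ v

open Enumeration

enumerate : (S : Subset n) → ∣ S ∣ ≡ r → Enumeration S r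
enumerate S refl = record
  { element    = enum S
  ; monotone   = enum-strictlyMonotone S
  ; ∈-set      = enum-∈ S
  ; surjective = enum-surjective S
  }

map-element-isOrdering : {S : Subset n} (E : Enumeration S r) {e : Vec (Fin r) r} →
                         IsPermutation e → IsOrderingOf S (map (element E) e)
map-element-isOrdering {S = S} E {e} (unique , complete) =
  Vecᵁ.map⁺ (strictlyMonotone⇒injective (monotone E)) unique ,
  λ v → mk⇔ from to
  where
  from : ∀ {v} → v Vec.∈ map (element E) e → v ∈ₛ S
  from v∈ with i , refl ← Anyᵛ.satisfied (Anyᵛ.map⁻ v∈) = ∈-set E i

  to : ∀ {v} → v ∈ₛ S → v Vec.∈ map (element E) e
  to v∈S with i , refl ← surjective E v∈S = ∈-map⁺ (element E) (complete i)

ordering-determines-set : {S T : Subset n} {e : Vec (Fin n) r} →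
                          IsOrderingOf S e → IsOrderingOf T e → S ≡ T
ordering-determines-set (_ , eS) (_ , eT) = ⊆-antisym
  (λ {v} → Equivalence.to (eT v) ∘ Equivalence.from (eS v))
  (λ {v} → Equivalence.to (eS v) ∘ Equivalence.from (eT v))

subset-of-size : r ≤ n → ∃[ S ] ∣_∣ {n} S ≡ r
subset-of-size {n = n} z≤n = ∅ , ∣⊥∣≡0 n
subset-of-size (s≤s r≤n) with S , eq ← subset-of-size r≤n =
  inside ∷ S , cong suc eq

-- The tournament of peaked orderings.

peakOrderings : ∀ {m} {S : Subset n} → Enumeration S (3 + m) →
                List (Vec (Fin n) (3 + m))
peakOrderings {m = m} E = List.map (map (element E)) (peakPermutations m)

peakOrderings-sound : ∀ {m} {S : Subset n} (E : Enumeration S (3 + m)) {e} →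
                      e List.∈ peakOrderings E → IsOrderingOf S e × Peak m e
peakOrderings-sound {m = m} E e∈
  with _ , p∈ , refl ← List.∈-map⁻ (map (element E)) e∈
  with perm , peak ← peakPermutations-sound m p∈ =
  map-element-isOrdering E perm , map-peak (monotone E) m peak

-- Any `k` peaked orderings of `S` would do; `take` fixes a choice. The list formally depends on the
-- proof of the size equation.
chosenOrderings : ∀ {m} → ℕ → (S : Subset n) → ∣ S ∣ ≡ 3 + m →
                  List (Vec (Fin n) (3 + m))
chosenOrderings k S ∣S∣≡r = take k (peakOrderings (enumerate S ∣S∣≡r))

chosenOrderings-sound : ∀ {m} k (S : Subset n) (∣S∣≡r : ∣ S ∣ ≡ 3 + m) {e} →
  e List.∈ chosenOrderings k S ∣S∣≡r → IsOrderingOf S e × Peak m e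
chosenOrderings-sound k S ∣S∣≡r e∈ =
  peakOrderings-sound (enumerate S ∣S∣≡r) (lookup (take-⊆ k _) e∈)

length-chosenOrderings : ∀ {m} k (S : Subset n) (∣S∣≡r : ∣ S ∣ ≡ 3 + m) →
  3 * k ≤ (3 + m) ! → length (chosenOrderings k S ∣S∣≡r) ≡ k
length-chosenOrderings {m = m} k S ∣S∣≡r 3k≤r! = begin
  length (take k L)
    ≡⟨ length-take k L ⟩
  k ℕ.⊓ length L
    ≡⟨ cong (k ℕ.⊓_) (length-map _ (peakPermutations m)) ⟩
  k ℕ.⊓ length (peakPermutations m)
    ≡⟨ ℕ.m≤n⇒m⊓n≡m k≤length ⟩
  k ∎
  where
  open ≡-Reasoning
  L = peakOrderings (enumerate S ∣S∣≡r)

  k≤length : k ≤ length (peakPermutations m)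
  -- Cancelling 3 from the bound on `k` shows that there are enough peaked orderings for `take` to
  -- return `k` of them.
  k≤length = ℕ.*-cancelˡ-≤ 3
         (subst (3 * k ≤_) (sym (length-peakPermutations m)) 3k≤r!)

chosenOrderings-unique : ∀ {m} k (S : Subset n) (∣S∣≡r : ∣ S ∣ ≡ 3 + m) →
                         List.Unique (chosenOrderings k S ∣S∣≡r)
chosenOrderings-unique {m = m} k S ∣S∣≡r = Listᵁ.take⁺ k
  (Listᵁ.map⁺
    (map-injective (strictlyMonotone⇒injective (monotone (enumerate S ∣S∣≡r))))
    (peakPermutations-unique m))

peakTournament : ∀ n m → ℕ → Digraph (3 + m) n
peakTournament n m k = record
  { Edge     = λ e → Σ[ S ∈ Subset n ] Σ[ ∣S∣≡r ∈ ∣ S ∣ ≡ 3 + m ]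
                 e List.∈ chosenOrderings k S ∣S∣≡r
  ; distinct = λ (S , ∣S∣≡r , e∈) →
                 proj₁ (proj₁ (chosenOrderings-sound k S ∣S∣≡r e∈))
  }

-- An edge chosen for some set `T` is an ordering of `T`; if it also orders `S`, then `T` equals
-- `S`. Hence the edges on `S` are exactly those chosen for `S`.
peakTournament-isTournament : ∀ m → 3 * k ≤ (3 + m) ! →
                              IsTournament k (peakTournament n m k)
peakTournament-isTournament {k = k} {n = n} m 3k≤r! S ∣S∣≡r =
  chosenOrderings k S ∣S∣≡r ,
  chosenOrderings-unique k S ∣S∣≡r ,
  length-chosenOrderings k S ∣S∣≡r 3k≤r! ,
  λ e → mk⇔
    (λ e∈ → proj₁ (chosenOrderings-sound k S ∣S∣≡r e∈) , S , ∣S∣≡r , e∈)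
    (λ (ordering , edge) → chosen ordering edge)
  where
  chosen : ∀ {e} → IsOrderingOf S e → Edge (peakTournament n m k) e →
           e List.∈ chosenOrderings k S ∣S∣≡r
  chosen ordering (T , ∣T∣≡r , e∈)
    with refl ← ordering-determines-set ordering
                  (proj₁ (chosenOrderings-sound k T ∣T∣≡r e∈))
    -- The two lists could still differ through their size proofs, but equality proofs in `ℕ` are
    -- unique.
    rewrite ℕ.≡-irrelevant ∣S∣≡r ∣T∣≡r = e∈

edge⇒peak : ∀ m k {e} → Edge (peakTournament n m k) e → Peak m e
edge⇒peak m k (S , ∣S∣≡r , e∈) = proj₂ (chosenOrderings-sound k S ∣S∣≡r e∈)

-- Upper and lower bounds on the path length.

map-toℕ-tabulate : (f : Fin r → Fin n) (g : Fin r → ℕ) →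
                   (∀ j → toℕ (f j) ≡ g j) → map toℕ (tabulate f) ≡ tabulate g
map-toℕ-tabulate f g f≗g =
  trans (sym (tabulate-∘ toℕ f)) (tabulate-cong f≗g)

-- The first `4 + m` vertices of the path already carry two overlapping edges, at offsets 0 and 1,
-- whose images would be consecutive peaked windows.
peakTournament-avoids : ∀ m k {t} → 3 + m < t →
  Contains (peakTournament n m k) (tightPath (3 + m) t) → ⊥
peakTournament-avoids m k {t} r<t (φ , _ , edge) =
  consecutive-peaks m (φ ∘ ι) (peak {ι ∘ inject₁} first) (peak {ι ∘ suc} second)
  where
  ι : Fin (4 + m) → Fin t
  ι i = inject≤ i r<t

  first : IsConsecutive (tabulate (ι ∘ inject₁))
  first = 0 , ℕ.<⇒≤ r<t , map-toℕ-tabulate _ _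
    (λ j → trans (toℕ-inject≤ (inject₁ j) r<t) (toℕ-inject₁ j))

  second : IsConsecutive (tabulate (ι ∘ suc))
  -- The window at offset 1 fits because `r<t` unfolds to `1 + (3 + m) ≤ t`.
  second = 1 , r<t , map-toℕ-tabulate _ _ (λ j → toℕ-inject≤ (suc j) r<t)

  peak : ∀ {h} → IsConsecutive (tabulate h) → Peak m (tabulate (φ ∘ h))
  peak {h} consecutive = subst (Peak m) (sym (tabulate-∘ φ h))
    (edge⇒peak m k (edge (tabulate h) consecutive))

-- A tight path on `r` vertices has a single edge, so any edge of `G`, read as a map from positions
-- to vertices, is a copy of it.
lookup-edge-contains : {G : Digraph r n} {e : Vec (Fin n) r} →
                       Edge G e → Contains G (tightPath r r)
lookup-edge-contains {r} {G = G} {e} edge =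
  Vec.lookup e , Vecᵁ.lookup-injective (distinct G edge) _ _ , preserves
  where
  preserves : ∀ e′ → IsConsecutive {r} {r} e′ → Edge G (map (Vec.lookup e) e′)
  preserves e′ (i , i+r≤r , eq)
    -- Only offset 0 fits into `r` positions, which makes `e′` the list of all positions in order.
    with refl ← ℕ.n≤0⇒n≡0 (ℕ.+-cancelʳ-≤ r i 0 i+r≤r) =
    subst (Edge G) (sym (begin
      map (Vec.lookup e) e′             ≡⟨ cong (map _) e′≡allFin ⟩
      map (Vec.lookup e) (Vec.allFin r) ≡⟨ map-lookup-allFin e ⟩
      e                                 ∎)) edge
    where
    open ≡-Reasoning
    e′≡allFin : e′ ≡ Vec.allFin r
    e′≡allFin = map-injective toℕ-injective
      (trans eq (sym (map-toℕ-tabulate id toℕ (λ _ → refl))))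

edge-unavoidable : r ≤ n → 0 < k → Unavoidable n r k r
edge-unavoidable r≤n 0<k G tournament
  with S , ∣S∣≡r ← subset-of-size r≤n
  with tournament S ∣S∣≡r
-- Some set of size `r` exists since `r ≤ n`; an empty list of its edges would mean `k = 0`.
... | []    , _ , refl , _      = contradiction 0<k ℕ.n≮0
... | e ∷ _ , _ , _    , sound  =
  lookup-edge-contains {G = G}
    (proj₂ (Equivalence.to (sound e) (here refl)))

proposition1 : (n r k : ℕ) → r ≤ n → 1 ≤ r → 0 < k → 3 * k ≤ r ! → f⟨ n , r , k ⟩≡ r
proposition1 n (suc (suc (suc m))) k r≤n _ 0<k 3k≤r! =
  edge-unavoidable r≤n 0<k ,
  λ t unavoidable → ℕ.≮⇒≥ λ r<t →
    peakTournament-avoids m k r<t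
      (unavoidable (peakTournament n m k) (peakTournament-isTournament m 3k≤r!))
-- For `r` equal to 1 or 2 the factorial is below 3, so no positive `k` satisfies the bound.
proposition1 n 1 (suc k) _ _ _ 3k≤1 =
  contradiction (ℕ.≤-trans (ℕ.*-monoʳ-≤ 3 (s≤s (z≤n {k}))) 3k≤1) λ { (s≤s ()) }
proposition1 n 2 (suc k) _ _ _ 3k≤2 =
  contradiction (ℕ.≤-trans (ℕ.*-monoʳ-≤ 3 (s≤s (z≤n {k}))) 3k≤2) λ { (s≤s (s≤s ())) }
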